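{- Assume the continuum hypothesis. Let $\lambda$ be a cardinal with $\omega_1<\lambda<2^{\omega_1}$, and suppose that there is a model $\mathcal M$ of cardinality $\omega_1$ with exactly $\lambda$ automorphisms. Then there exists a tree $T$ of height $\omega_1$ such that (i) $T$ has exactly $\lambda$ uncountable branches, and (ii) each level of $T$ has at most $\omega_1$ nodes.
   Context: A tree is a partially ordered set in which the set of predecessors of every node is well-ordered; the height of a node is the order type of its set of predecessors, and the levels are the sets of nodes of a given height. A branch is a maximal linearly ordered subset; in a tree of height $\omega_1$ the uncountable branches are those of order type $\omega_1$. Models are structures for an arbitrary vocabulary of finitary symbols. -}

module Defs where

open import Data.Bool.Base using (Bool)
open import Data.Fin.Base using (Fin)
open import Data.Nat.Base using (ℕ)
open import Data.Product.Base using (Σ; ∃; _×_; proj₁)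
open import Data.Sum.Base using (_⊎_)
open import Function.Base using (_on_; _∘_)
open import Function.Bundles using (Injection; Inverse; _⇔_)
import Function.Relation.Binary.Setoid.Equality as FuncEq
open import Induction.WellFounded using (WellFounded)
open import Level using (Level; _⊔_; suc)
open import Relation.Binary.Bundles using (Poset; Setoid)
open import Relation.Binary.Core using (Rel)
import Relation.Binary.Construct.NonStrictToStrict as ToStrict
import Relation.Binary.Construct.On as On
open import Relation.Binary.Morphism.Structures using (IsOrderIsomorphism)
open import Relation.Binary.PropositionalEquality using (setoid)
open import Relation.Binary.Structures using (IsStrictTotalOrder)
open import Relation.Nullary.Negation.Core using (¬_)
open import Relation.Unary using (Pred; _⊆_)
open import Relation.Unary.Relation.Binary.Equality using (≐-setoid)

private
  variable
    a b c d p ℓ : Level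

------------------------------------------------------------------------
-- Cardinality
--
-- A set is a setoid (so that quotients and function spaces are available
-- without further axioms); a cardinal is a setoid considered up to _≈ᶜ_.

_≈ᶜ_ : Setoid a b → Setoid c d → Set (a ⊔ b ⊔ c ⊔ d)
_≈ᶜ_ = Inverse

_≤ᶜ_ : Setoid a b → Setoid c d → Set (a ⊔ b ⊔ c ⊔ d)
_≤ᶜ_ = Injection

_<ᶜ_ : Setoid a b → Setoid c d → Set (a ⊔ b ⊔ c ⊔ d)
A <ᶜ B = A ≤ᶜ B × ¬ (B ≤ᶜ A)

infix 4 _≈ᶜ_ _≤ᶜ_ _<ᶜ_

2^_ : Setoid a b → Setoid (a ⊔ b) a
2^ A = FuncEq.setoid A (setoid Bool)

infix 8 2^_

Countable Uncountable : Setoid a b → Set (a ⊔ b)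
Countable A = A ≤ᶜ setoid ℕ
Uncountable A = ¬ Countable A

subsetoid : (A : Setoid a b) → Pred (Setoid.Carrier A) p → Setoid (a ⊔ p) b
subsetoid A P = On.setoid {B = ∃ P} A proj₁

------------------------------------------------------------------------
-- Well-orders and ω₁

record IsWellOrder {A : Set a} (_≈_ : Rel A b) (_<_ : Rel A c) : Set (a ⊔ b ⊔ c) where
  field
    isStrictTotalOrder : IsStrictTotalOrder _≈_ _<_
    wellFounded        : WellFounded _<_

  open IsStrictTotalOrder isStrictTotalOrder public

record WellOrder ℓ : Set (suc ℓ) where
  field
    Carrier     : Set ℓ
    _≈_         : Rel Carrier ℓ
    _<_         : Rel Carrier ℓ
    isWellOrder : IsWellOrder _≈_ _<_

  open IsWellOrder isWellOrder public

  asSetoid : Setoid ℓ ℓ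
  asSetoid = record { isEquivalence = isEquivalence }

-- The least uncountable order type.
record IsOmega₁ (O : WellOrder ℓ) : Set ℓ where
  open WellOrder O
  field
    uncountable       : Uncountable asSetoid
    segmentsCountable : ∀ α → Countable (subsetoid asSetoid (_< α))

-- The continuum hypothesis 2^ℵ₀ = ℵ₁, for O of order type ω₁.
CH : WellOrder ℓ → Set ℓ
CH O = 2^ (setoid ℕ) ≈ᶜ WellOrder.asSetoid O

------------------------------------------------------------------------
-- Models and their automorphisms

record Vocabulary ℓ : Set (suc ℓ) where
  field
    Fun      : Set ℓ
    funArity : Fun → ℕ
    Rln      : Set ℓ
    rlnArity : Rln → ℕ

record Model (V : Vocabulary ℓ) : Set (suc ℓ) where
  open Vocabulary V
  field
    universe : Setoid ℓ ℓ

  open Setoid universe public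

  field
    fun      : (f : Fun) → (Fin (funArity f) → Carrier) → Carrier
    fun-cong : ∀ f {xs ys} → (∀ i → xs i ≈ ys i) → fun f xs ≈ fun f ys
    rln      : (R : Rln) → Pred (Fin (rlnArity R) → Carrier) ℓ
    rln-resp : ∀ R {xs ys} → (∀ i → xs i ≈ ys i) → rln R xs → rln R ys

module _ {V : Vocabulary ℓ} (M : Model V) where
  open Model M

  record Automorphism : Set ℓ where
    field
      inverse : Inverse universe universe

    open Inverse inverse public

    field
      fun-homo : ∀ f xs → to (fun f xs) ≈ fun f (to ∘ xs)
      rln-homo : ∀ R xs → rln R xs ⇔ rln R (to ∘ xs)

  Automorphisms : Setoid ℓ ℓ
  Automorphisms = record
    { Carrier       = Automorphism
    ; _≈_           = λ σ τ → ∀ x → Automorphism.to σ x ≈ Automorphism.to τ x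
    ; isEquivalence = record
      { refl  = λ _ → refl
      ; sym   = λ σ≈τ x → sym (σ≈τ x)
      ; trans = λ σ≈τ τ≈υ x → trans (σ≈τ x) (τ≈υ x)
      }
    }

------------------------------------------------------------------------
-- Trees

record Tree ℓ : Set (suc ℓ) where
  field
    poset : Poset ℓ ℓ ℓ

  open Poset poset public using (_≈_; _≤_; module Eq) renaming (Carrier to Node)
  open ToStrict _≈_ _≤_ public using (_<_)

  nodes : Setoid ℓ ℓ
  nodes = Eq.setoid

  Predecessor : Node → Set ℓ
  Predecessor x = ∃ λ y → y < x

  field
    predecessors-wellOrdered : ∀ x →
      IsWellOrder {A = Predecessor x} (_≈_ on proj₁) (_<_ on proj₁)

module _ (O : WellOrder ℓ) (T : Tree ℓ) where
  private module O = WellOrder O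
  open Tree T

  -- The ordinal represented by α is the order type of { β | β < α }.
  HasHeight : Node → O.Carrier → Set ℓ
  HasHeight x α = Σ (Predecessor x → ∃ (O._< α)) λ h →
    IsOrderIsomorphism (_≈_ on proj₁) (O._≈_ on proj₁)
                       (_<_ on proj₁) (O._<_ on proj₁) h

  Level[_] : O.Carrier → Setoid ℓ ℓ
  Level[ α ] = subsetoid nodes (λ x → HasHeight x α)

  -- The height of T is the least ordinal whose level is empty; that this is
  -- the order type of O means that the heights of nodes are exactly the
  -- elements of O.
  TreeHasHeight : Set ℓ
  TreeHasHeight = (∀ x → ∃ λ α → HasHeight x α) × (∀ α → ∃ λ x → HasHeight x α)

module _ (T : Tree ℓ) where
  open Tree T

  IsChain : Pred Node ℓ → Set ℓ
  IsChain C = ∀ {x y} → C x → C y → x ≤ y ⊎ y ≤ x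

  -- Maximality forces a branch to be closed under _≈_.
  record IsBranch (C : Pred Node ℓ) : Set (suc ℓ) where
    field
      isChain : IsChain C
      maximal : ∀ {D : Pred Node ℓ} → IsChain D → C ⊆ D → D ⊆ C

  IsUncountableBranch : Pred Node ℓ → Set (suc ℓ)
  IsUncountableBranch C = IsBranch C × Uncountable (subsetoid nodes C)

  UncountableBranches : Setoid (suc ℓ) ℓ
  UncountableBranches = subsetoid (≐-setoid Node ℓ) IsUncountableBranch

-- After identifying the universe of M with ω₁, the nodes at level α are the restrictions to α
-- of pairs (σ , σ⁻¹), σ an automorphism.  Such a restriction is a countable family of points
-- of ω₁ = 2^ℕ, so CH bounds each level by ω₁.  An uncountable branch glues to a pair of mutually
-- inverse maps, and since symbols are finitary every instance of the homomorphism conditions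
-- is already seen at one node of the branch.  Keeping σ⁻¹ next to σ is what makes the glued
-- map surjective.
module Submission where

open import Defs
open import Axiom.ExcludedMiddle using (ExcludedMiddle)
open import Data.Bool.Base using (Bool; true; false)
open import Data.Bool.Properties using (⇔→≡)
open import Data.Empty using (⊥-elim)
open import Data.Fin.Base using (Fin; zero)
open import Data.Nat.Base using (ℕ; zero; _*_)
open import Data.Nat.Properties using (suc-injective; *-cancelˡ-≡; even≢odd)
open import Data.Product.Base using (Σ; ∃; _×_; _,_; proj₁; proj₂)
open import Data.Product.Function.NonDependent.Setoid using (_×-injection_)
open import Data.Product.Relation.Binary.Pointwise.NonDependent using (_×ₛ_)
open import Data.Sum.Base using (inj₁; inj₂; [_,_]′)
import Data.Sum.Base as Sum
open import Data.Vec.Functional using ([]; _∷_)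
open import Function.Base using (_∘_; _on_)
open import Function.Bundles using (Func; Injection; Inverse; Equivalence; _⇔_; mk⇔)
import Function.Construct.Composition as Compose
import Function.Construct.Identity as Identity
import Function.Construct.Symmetry as Symmetry
open import Function.Properties.Inverse using (Inverse⇒Injection)
open import Induction.WellFounded using (Acc; acc; module Subrelation)
open import Level using (Level; suc; Lift; lift; lower)
open import Relation.Binary.Bundles using (Setoid)
import Relation.Binary.Construct.On as On
import Relation.Binary.Construct.StrictToNonStrict as ToNonStrict
open import Relation.Binary.Definitions using (tri<; tri≈; tri>)
open import Relation.Binary.Morphism.Structures using (IsOrderMonomorphism; IsOrderIsomorphism)
import Relation.Binary.Morphism.OrderMonomorphism as OrderMonomorphism
open import Relation.Binary.PropositionalEquality as ≡ using (_≡_; refl; setoid)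
open import Relation.Binary.Structures using (IsTotalOrder)
open import Relation.Nullary.Decidable.Core using (Dec; yes; no; does; map′)
open import Relation.Nullary.Negation.Core using (¬_)
open import Relation.Unary using (Pred; _⊆_; _≐_)

private
  variable
    a b c d p q ℓ : Level

-- Countable sets and their power sets.

lowerEM : ExcludedMiddle (suc ℓ) → ExcludedMiddle ℓ
lowerEM {ℓ} em {P} = map′ lower lift (em {Lift (suc ℓ) P})

≤ᶜ-trans : {A : Setoid a b} {B : Setoid c d} {C : Setoid p q} → A ≤ᶜ B → B ≤ᶜ C → A ≤ᶜ C
≤ᶜ-trans = Compose.injection

-- pair m n = 2 ^ m * (1 + 2 * n)
pair : ℕ → ℕ → ℕ
pair zero      n = ℕ.suc (2 * n)
pair (ℕ.suc m) n = 2 * pair m n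

pair-injective : ∀ m n m′ n′ → pair m n ≡ pair m′ n′ → m ≡ m′ × n ≡ n′
pair-injective zero      n zero      n′ eq = refl , *-cancelˡ-≡ n n′ 2 (suc-injective eq)
pair-injective zero      n (ℕ.suc m′) n′ eq = ⊥-elim (even≢odd (pair m′ n′) n (≡.sym eq))
pair-injective (ℕ.suc m) n zero      n′ eq = ⊥-elim (even≢odd (pair m n) n′ eq)
pair-injective (ℕ.suc m) n (ℕ.suc m′) n′ eq
  with pair-injective m n m′ n′ (*-cancelˡ-≡ (pair m n) (pair m′ n′) 2 eq)
... | refl , refl = refl , refl

ℕ×ℕ-countable : Countable (setoid ℕ ×ₛ setoid ℕ)
ℕ×ℕ-countable = record
  { to        = λ (m , n) → pair m n
  ; cong      = λ { (refl , refl) → refl }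
  ; injective = λ {(m , n)} {(m′ , n′)} → pair-injective m n m′ n′
  }

×-countable : {A : Setoid a b} {B : Setoid c d} → Countable A → Countable B → Countable (A ×ₛ B)
×-countable A B = ≤ᶜ-trans (A ×-injection B) ℕ×ℕ-countable

Bool-countable : Countable (setoid Bool)
Bool-countable = record
  { to        = λ { false → 0 ; true → 1 }
  ; cong      = λ { refl → refl }
  ; injective = λ { {false} {false} _ → refl ; {true} {true} _ → refl }
  }

module _ (em : ExcludedMiddle a) {A : Setoid a a} (A-countable : Countable A) where
  private
    open Injection A-countable

    -- The image of the subset of A with characteristic function f.
    Image : Func A (setoid Bool) → Pred ℕ a
    Image f n = ∃ λ x → n ≡ to x × Func.to f x ≡ true

    image : Func A (setoid Bool) → ℕ → Bool
    image f n = does (em {Image f n})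

    does-true : ∀ {P : Set a} (P? : Dec P) → P → does P? ≡ true
    does-true (yes _) _ = refl
    does-true (no ¬p) p = ⊥-elim (¬p p)

    true-does : ∀ {P : Set a} (P? : Dec P) → does P? ≡ true → P
    true-does (yes p) _ = p

    image-mono : ∀ f g → (∀ x → Func.to f x ≡ true → Func.to g x ≡ true) →
                 ∀ n → image f n ≡ true → image g n ≡ true
    image-mono f g f⊆g n n∈f with true-does em n∈f
    ... | x , n≡x , x∈f = does-true em (x , n≡x , f⊆g x x∈f)

    image-reflects : ∀ f g → (∀ n → image f n ≡ image g n) →
                     ∀ x → Func.to f x ≡ true → Func.to g x ≡ true
    image-reflects f g eq x x∈f
      with true-does em (≡.trans (≡.sym (eq (to x))) (does-true em (x , refl , x∈f)))
    ... | y , x≡y , y∈g = ≡.trans (Func.cong g (injective x≡y)) y∈g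

  -- Subsets go to their direct images. Excluded middle makes an image `Bool`-valued, and
  -- injectivity of `to` recovers the subset from it.
  2^-countable≤2^ℕ : 2^ A ≤ᶜ 2^ (setoid ℕ)
  2^-countable≤2^ℕ = record
    { to        = λ f → record { to = image f ; cong = ≡.cong (image f) }
    ; cong      = λ {f} {g} f≈g n → ⇔→≡
        (mk⇔ (image-mono f g (λ x → ≡.trans (≡.sym (f≈g x))) n)
             (image-mono g f (λ x → ≡.trans (f≈g x)) n))
    ; injective = λ {f} {g} eq x → ⇔→≡
        (mk⇔ (image-reflects f g eq x) (image-reflects g f (λ n → ≡.sym (eq n)) x))
    }

-- Well-orders and uniqueness of heights.

module WellOrderProperties (O : WellOrder ℓ) where
  open WellOrder O public
  open ToNonStrict _≈_ _<_ public using (_≤_; <-≤-trans)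
  module ≤ = IsTotalOrder (ToNonStrict.isTotalOrder _≈_ _<_ isStrictTotalOrder)

  <-respʳ : ∀ {α β γ} → β ≈ γ → α < β → α < γ
  <-respʳ = proj₁ <-resp-≈

  <-respˡ : ∀ {α β γ} → β ≈ γ → β < α → γ < α
  <-respˡ = proj₂ <-resp-≈

  <-≤ : ∀ {α β γ} → α < β → β ≤ γ → α < γ
  <-≤ = <-≤-trans trans <-respʳ

  ≮⇒≥ : ∀ {α β} → ¬ (α < β) → β ≤ α
  ≮⇒≥ {α} {β} α≮β with compare α β
  ... | tri< α<β _ _ = ⊥-elim (α≮β α<β)
  ... | tri≈ _ α≈β _ = inj₂ (Eq.sym α≈β)
  ... | tri> _ _ β<α = inj₁ β<α

  -- Infinite descent: a counterexample `ξ` makes `f ξ` a smaller one.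
  mono⇒inflationary : ∀ {α} (f : ∃ (_< α) → ∃ (_< α)) →
                      (∀ {ξ η} → proj₁ ξ < proj₁ η → proj₁ (f ξ) < proj₁ (f η)) →
                      ∀ ξ → ¬ (proj₁ (f ξ) < proj₁ ξ)
  mono⇒inflationary f mono ξ = go ξ (wellFounded (proj₁ ξ))
    where
    go : ∀ ξ → Acc _<_ (proj₁ ξ) → ¬ (proj₁ (f ξ) < proj₁ ξ)
    go ξ (acc rs) fξ<ξ = go (f ξ) (rs fξ<ξ) (mono fξ<ξ)

module _ (O : WellOrder ℓ) (T : Tree ℓ) where
  private
    module O = WellOrderProperties O
    open Tree T

    -- Composing the two height isomorphisms gives a strictly increasing map of the
    -- segment below α into the segment below β.
    height-≮ : ∀ {x α β} → HasHeight O T x α → HasHeight O T x β → ¬ (β O.< α)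
    height-≮ {x} {α} {β} (f , f-iso) (g , g-iso) β<α =
      -- All values of `h` lie below `β`, and `β` is itself in its domain, so `h` moves `β` down.
      O.mono⇒inflationary h h-mono (β , β<α) (proj₂ (g (f⁻¹ (β , β<α))))
      where
      module F = IsOrderIsomorphism f-iso
      module G = IsOrderIsomorphism g-iso
      f⁻¹ : ∃ (O._< α) → Predecessor x
      f⁻¹ ξ = proj₁ (F.surjective ξ)
      f-f⁻¹ : ∀ ξ → proj₁ (f (f⁻¹ ξ)) O.≈ proj₁ ξ
      f-f⁻¹ ξ = proj₂ (F.surjective ξ) Eq.refl
      h : ∃ (O._< α) → ∃ (O._< α)
      h ξ = proj₁ (g (f⁻¹ ξ)) , O.trans (proj₂ (g (f⁻¹ ξ))) β<α
      h-mono : ∀ {ξ η} → proj₁ ξ O.< proj₁ η → proj₁ (h ξ) O.< proj₁ (h η)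
      h-mono {ξ} {η} ξ<η = G.mono (F.cancel
        (O.<-respˡ (O.Eq.sym (f-f⁻¹ ξ)) (O.<-respʳ (O.Eq.sym (f-f⁻¹ η)) ξ<η)))

  -- `Level[ α ]` asks only for some isomorphism onto the segment below `α`; uniqueness identifies
  -- `α` with a height already known for the node.
  height-unique : ∀ {x α β} → HasHeight O T x α → HasHeight O T x β → α O.≈ β
  height-unique {α = α} {β} hα hβ with O.compare α β
  ... | tri< α<β _ _ = ⊥-elim (height-≮ hβ hα α<β)
  ... | tri≈ _ α≈β _ = α≈β
  ... | tri> _ _ β<α = ⊥-elim (height-≮ hα hβ β<α)

module _ {O : WellOrder ℓ} (isω₁ : IsOmega₁ O) where
  open WellOrderProperties O
  open IsOmega₁ isω₁

  closedSegmentsCountable : ∀ γ → Countable (subsetoid asSetoid (_≤ γ))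
  closedSegmentsCountable γ = record
    -- The endpoint takes `zero`, and the open segment is shifted by one to make room.
    { to        = λ { (α , inj₁ α<γ) → ℕ.suc (S.to (α , α<γ)) ; (α , inj₂ _) → zero }
    ; cong      = λ { {_ , inj₁ _}   {_ , inj₁ _}   α≈β → ≡.cong ℕ.suc (S.cong α≈β)
                    ; {_ , inj₁ α<γ} {_ , inj₂ β≈γ} α≈β → ⊥-elim (irrefl (Eq.trans α≈β β≈γ) α<γ)
                    ; {_ , inj₂ α≈γ} {_ , inj₁ β<γ} α≈β →
                        ⊥-elim (irrefl (Eq.trans (Eq.sym α≈β) α≈γ) β<γ)
                    ; {_ , inj₂ _}   {_ , inj₂ _}   _   → refl }
    ; injective = λ { {_ , inj₁ _}   {_ , inj₁ _}   eq → S.injective (suc-injective eq)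
                    ; {_ , inj₂ α≈γ} {_ , inj₂ β≈γ} _  → Eq.trans α≈γ (Eq.sym β≈γ) }
    }
    where module S = Injection (segmentsCountable γ)

-- Automorphisms together with their inverses.

module _ {V : Vocabulary ℓ} {M : Model V} where
  private module M = Model M

  idAutomorphism : Automorphism M
  idAutomorphism = record
    { inverse  = Identity.inverse M.universe
    ; fun-homo = λ _ _ → M.refl
    ; rln-homo = λ _ _ → mk⇔ (λ r → r) (λ r → r)
    }

  -- The `Bool` chooses a direction, so that the pair (σ , σ⁻¹) is handled as one indexed family.
  act : Bool → Automorphism M → M.Carrier → M.Carrier
  act true  = Automorphism.to
  act false = Automorphism.from

  act-cong : ∀ s σ {x y} → x M.≈ y → act s σ x M.≈ act s σ y
  act-cong true  = Automorphism.to-cong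
  act-cong false = Automorphism.from-cong

  -- Equality of automorphisms compares only `to`. For the inverses, σ⁻¹ x = τ⁻¹ (τ (σ⁻¹ x)) = τ⁻¹
  -- (σ (σ⁻¹ x)) = τ⁻¹ x.
  act-resp : ∀ s {σ τ} → Setoid._≈_ (Automorphisms M) σ τ → ∀ x → act s σ x M.≈ act s τ x
  act-resp true          σ≈τ x = σ≈τ x
  act-resp false {σ} {τ} σ≈τ x = M.trans
    (M.sym (τ.strictlyInverseʳ (σ.from x)))
    (τ.from-cong (M.trans (M.sym (σ≈τ (σ.from x))) (σ.strictlyInverseˡ x)))
    where
    module σ = Automorphism σ
    module τ = Automorphism τ

-- The tree of restrictions.

module RestrictionTree
  (O : WellOrder ℓ) {V : Vocabulary ℓ} (M : Model V)
  (M≤O : Model.universe M ≤ᶜ WellOrder.asSetoid O)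
  where

  private
    module M = Model M
    module O = WellOrderProperties O
    open Injection M≤O using ()
      renaming (to to code; cong to code-cong; injective to code-injective)
    Aut = Automorphism M

  -- Only arguments are bounded by `α`; values may have codes above it.
  record _≈[_]_ (σ : Aut) (α : O.Carrier) (τ : Aut) : Set ℓ where
    constructor agreement
    field
      agree : ∀ s {x} → code x O.< α → act s σ x M.≈ act s τ x
  open _≈[_]_ public

  ≈[]-refl : ∀ {σ α} → σ ≈[ α ] σ
  ≈[]-refl = agreement λ _ _ → M.refl

  ≈[]-sym : ∀ {σ τ α} → σ ≈[ α ] τ → τ ≈[ α ] σ
  ≈[]-sym p = agreement λ s x<α → M.sym (agree p s x<α)

  ≈[]-trans : ∀ {σ τ υ α} → σ ≈[ α ] τ → τ ≈[ α ] υ → σ ≈[ α ] υ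
  ≈[]-trans p q = agreement λ s x<α → M.trans (agree p s x<α) (agree q s x<α)

  ≈[]-restrict : ∀ {σ τ α β} → α O.≤ β → σ ≈[ β ] τ → σ ≈[ α ] τ
  ≈[]-restrict α≤β p = agreement λ s x<α → agree p s (O.<-≤ x<α α≤β)

  -- (α , σ) stands for the restriction of (σ , σ⁻¹) to α.
  Node : Set ℓ
  Node = O.Carrier × Aut

  private
    _≈_ _≤_ _<_ : Node → Node → Set ℓ
    (α , σ) ≈ (β , τ) = α O.≈ β × σ ≈[ α ] τ
    (α , σ) ≤ (β , τ) = α O.≤ β × σ ≈[ α ] τ
    x < y = x ≤ y × ¬ (x ≈ y)

    <⇒height< : ∀ {x y} → x < y → proj₁ x O.< proj₁ y
    <⇒height< ((inj₁ α<β , _)   , _)   = α<β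
    <⇒height< ((inj₂ α≈β , σ≈τ) , x≉y) = ⊥-elim (x≉y (α≈β , σ≈τ))

    height<⇒< : ∀ {α σ β τ} → α O.< β → σ ≈[ α ] τ → (α , σ) < (β , τ)
    height<⇒< α<β σ≈τ = (inj₁ α<β , σ≈τ) , λ (α≈β , _) → O.irrefl α≈β α<β

    Pred[_] : Node → Set ℓ
    Pred[ x ] = ∃ (_< x)

    height : ∀ {x} → Pred[ x ] → ∃ (O._< proj₁ x)
    height (y , y<x) = proj₁ y , <⇒height< y<x

    -- Both predecessors are restrictions of the automorphism at `x`, so the shorter restricts the
    -- longer. Hence predecessors are ordered by height alone.
    predecessors-agree : ∀ {x : Node} (y z : Pred[ x ]) → proj₁ (proj₁ y) O.≤ proj₁ (proj₁ z) →
                         proj₂ (proj₁ y) ≈[ proj₁ (proj₁ y) ] proj₂ (proj₁ z)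
    predecessors-agree (_ , ((_ , y≈x) , _)) (_ , ((_ , z≈x) , _)) y≤z =
      ≈[]-trans y≈x (≈[]-sym (≈[]-restrict y≤z z≈x))

    height-monomorphism : ∀ x → IsOrderMonomorphism {A = Pred[ x ]}
      (_≈_ on proj₁) (O._≈_ on proj₁) (_<_ on proj₁) (O._<_ on proj₁) height
    height-monomorphism x = record
      { isOrderHomomorphism = record { cong = proj₁ ; mono = <⇒height< }
      ; injective           = λ {y} {z} h≈ → h≈ , predecessors-agree y z (inj₂ h≈)
      ; cancel              = λ {y} {z} h< → height<⇒< h< (predecessors-agree y z (inj₁ h<))
      }

    height-isomorphism : ∀ x → IsOrderIsomorphism {A = Pred[ x ]}
      (_≈_ on proj₁) (O._≈_ on proj₁) (_<_ on proj₁) (O._<_ on proj₁) height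
    height-isomorphism x@(α , σ) = record
      { isOrderMonomorphism = height-monomorphism x
      -- The predecessor of height `β` is the same `σ`, restricted further.
      ; surjective          = λ (β , β<α) → ((β , σ) , height<⇒< β<α ≈[]-refl) , proj₁
      }

  tree : Tree ℓ
  tree = record
    { poset = record
      { Carrier = Node
      ; _≈_     = _≈_
      ; _≤_     = _≤_
      ; isPartialOrder = record
        { isPreorder = record
          { isEquivalence = record
            { refl  = O.Eq.refl , ≈[]-refl
            ; sym   = λ (α≈β , p) → O.Eq.sym α≈β , ≈[]-restrict (inj₂ (O.Eq.sym α≈β)) (≈[]-sym p)
            ; trans = λ (α≈β , p) (β≈γ , q) →
                O.Eq.trans α≈β β≈γ , ≈[]-trans p (≈[]-restrict (inj₂ α≈β) q)
            }
          ; reflexive = λ (α≈β , p) → inj₂ α≈β , p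
          ; trans     = λ (α≤β , p) (β≤γ , q) →
              O.≤.trans α≤β β≤γ , ≈[]-trans p (≈[]-restrict α≤β q)
          }
        ; antisym = λ (α≤β , p) (β≤α , _) → O.≤.antisym α≤β β≤α , p
        }
      }
    ; predecessors-wellOrdered = λ x → record
      { isStrictTotalOrder = OrderMonomorphism.isStrictTotalOrder (height-monomorphism x)
          (On.isStrictTotalOrder proj₁ O.isStrictTotalOrder)
      ; wellFounded = Subrelation.wellFounded <⇒height<
          (On.wellFounded (proj₁ ∘ proj₁) O.wellFounded)
      }
    }

  hasHeight : ∀ x → HasHeight O tree x (proj₁ x)
  hasHeight x = height , height-isomorphism x

  tree-hasHeight : TreeHasHeight O tree
  tree-hasHeight =
    (λ x → proj₁ x , hasHeight x) ,
    -- Restrictions of the identity populate every level.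
    (λ α → (α , idAutomorphism) , hasHeight (α , idAutomorphism))

  -- The size of the levels.

  module _ (em : ExcludedMiddle ℓ) (isω₁ : IsOmega₁ O) (ch : CH O) where
    private
      M≤2^ℕ : M.universe ≤ᶜ 2^ (setoid ℕ)
      M≤2^ℕ = ≤ᶜ-trans M≤O (Inverse⇒Injection (Symmetry.inverse ch))
      module bits = Injection M≤2^ℕ

      below : O.Carrier → Setoid ℓ ℓ
      below α = subsetoid M.universe (λ x → code x O.< α)

      below-countable : ∀ α → Countable (below α)
      below-countable α = ≤ᶜ-trans
        (record { to        = λ (x , x<α) → code x , x<α
                ; cong      = code-cong
                ; injective = code-injective })
        (IsOmega₁.segmentsCountable isω₁ α)

      -- `CH` read backwards turns each value into a bit sequence. Uncurrying, a node becomes a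
      -- single subset of a countable set of triples: point, direction, bit position.
      level≤2^ : ∀ α → Level[_] O tree α ≤ᶜ 2^ (below α ×ₛ (setoid Bool ×ₛ setoid ℕ))
      level≤2^ α = record
        { to        = λ ((_ , σ) , _) → record
            { to   = λ ((x , _) , s , n) → Func.to (bits.to (act s σ x)) n
            ; cong = λ { {_ , s , n} (x≈y , refl , refl) → bits.cong (act-cong s σ x≈y) n }
            }
        ; cong      = λ { {x , x-α} (_ , σ≈τ) ((_ , y<α) , s , n) →
            bits.cong (agree σ≈τ s (O.<-respʳ (height-unique O tree x-α (hasHeight x)) y<α)) n }
        ; injective = λ { {x , x-α} {y , y-α} eq →
            let x≈α = height-unique O tree (hasHeight x) x-α
                y≈α = height-unique O tree (hasHeight y) y-α
            in O.Eq.trans x≈α (O.Eq.sym y≈α) , agreement λ s z<x →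
                 bits.injective λ n → eq ((_ , O.<-respʳ x≈α z<x) , s , n) }
        }

    level≤ω₁ : ∀ α → Level[_] O tree α ≤ᶜ O.asSetoid
    level≤ω₁ α = ≤ᶜ-trans (level≤2^ α) (≤ᶜ-trans
      (2^-countable≤2^ℕ em (×-countable (below-countable α)
        (×-countable Bool-countable (Identity.injection (setoid ℕ)))))
      (Inverse⇒Injection ch))

  -- From automorphisms to branches.

  branch : Aut → Pred Node ℓ
  branch σ (α , τ) = τ ≈[ α ] σ

  module _ (σ : Aut) where
    branch-isChain : IsChain tree (branch σ)
    branch-isChain {α , τ} {β , υ} τ≈σ υ≈σ = Sum.map
      (λ α≤β → α≤β , ≈[]-trans τ≈σ (≈[]-sym (≈[]-restrict α≤β υ≈σ)))
      (λ β≤α → β≤α , ≈[]-trans υ≈σ (≈[]-sym (≈[]-restrict β≤α τ≈σ)))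
      (O.≤.total α β)

    branch-isBranch : IsBranch tree (branch σ)
    branch-isBranch = record
      { isChain = branch-isChain
      -- A node of `D` at height `α` is comparable with `(α , σ)`, and either comparison says that
      -- the two restrictions to `α` agree.
      ; maximal = λ D-chain σ⊆D {(α , _)} τ∈D →
          [ proj₂ , ≈[]-sym ∘ proj₂ ]′ (D-chain τ∈D (σ⊆D {α , σ} ≈[]-refl))
      }

    branch-uncountable : Uncountable O.asSetoid →
                         Uncountable (subsetoid (Tree.nodes tree) (branch σ))
    branch-uncountable O-uncountable countable = O-uncountable (≤ᶜ-trans
      (record { to = λ α → (α , σ) , ≈[]-refl ; cong = _, ≈[]-refl ; injective = proj₁ })
      countable)

  branch-cong : ∀ {σ τ} → (∀ s x → act s σ x M.≈ act s τ x) → branch σ ⊆ branch τ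
  branch-cong σ≈τ υ≈σ = agreement λ s x<α → M.trans (agree υ≈σ s x<α) (σ≈τ s _)

  -- From uncountable branches to automorphisms.

  module Glue
    (em : ExcludedMiddle ℓ) (isω₁ : IsOmega₁ O)
    {C : Pred Node ℓ} (C-isBranch : IsBranch tree C)
    (C-uncountable : Uncountable (subsetoid (Tree.nodes tree) C))
    where
    open IsBranch C-isBranch

    -- In a chain a node is determined by its height, so a bound `γ` on the heights would inject `C`
    -- into a countable segment.
    unbounded : ∀ γ → ∃ λ x → C x × γ O.< proj₁ x
    unbounded γ with em {∃ λ x → C x × γ O.< proj₁ x}
    ... | yes p = p
    ... | no ¬p = ⊥-elim (C-uncountable (≤ᶜ-trans heights (closedSegmentsCountable isω₁ γ)))
      where
      heights : subsetoid (Tree.nodes tree) C ≤ᶜ subsetoid O.asSetoid (O._≤ γ)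
      heights = record
        { to        = λ (x , x∈C) → proj₁ x , O.≮⇒≥ (λ γ<x → ¬p (x , x∈C , γ<x))
        ; cong      = proj₁
        ; injective = λ { {_ , x∈C} {_ , y∈C} α≈β → α≈β ,
            [ proj₂ , (λ y≤x → ≈[]-sym (≈[]-restrict (inj₂ α≈β) (proj₂ y≤x))) ]′
              (isChain x∈C y∈C) }
        }

    glue : Bool → M.Carrier → M.Carrier
    glue s x = act s (proj₂ (proj₁ (unbounded (code x)))) x

    -- Independence of the choice in `glue`: the chosen node and `(α , σ)` are comparable, and `x`
    -- lies below both heights.
    glue-agrees : ∀ {α σ} → C (α , σ) → ∀ s {x} → code x O.< α → glue s x M.≈ act s σ x
    glue-agrees σ∈C s {x} x<α with unbounded (code x)
    ... | (β , τ) , τ∈C , x<β with isChain τ∈C σ∈C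
    ...   | inj₁ (_ , τ≈σ) = agree τ≈σ s x<β
    ...   | inj₂ (_ , σ≈τ) = M.sym (agree σ≈τ s x<α)

    -- Serves the base case of `cover`, where no point is given to which `unbounded` could be
    -- applied.
    inhabited : ∃ C
    inhabited with em {∃ C}
    ... | yes p = p
    ... | no ¬p = ⊥-elim (C-uncountable record
      { to        = λ _ → 0
      ; cong      = λ _ → refl
      ; injective = λ {x} _ → ⊥-elim (¬p x)
      })

    -- Finite arity enters here: of two comparable nodes the higher serves for both, and induction
    -- extends this to any finite family.
    cover : ∀ {n} (xs : Fin n → M.Carrier) →
            ∃ λ x → C x × ∀ i → code (xs i) O.< proj₁ x
    cover {zero} xs with inhabited
    ... | x , x∈C = x , x∈C , λ ()
    cover {ℕ.suc n} xs with cover (xs ∘ Fin.suc) | unbounded (code (xs zero))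
    ... | x , x∈C , xs<x | z , z∈C , x₀<z with isChain x∈C z∈C
    ...   | inj₁ (x≤z , _) = z , z∈C , λ { zero → x₀<z ; (Fin.suc i) → O.<-≤ (xs<x i) x≤z }
    ...   | inj₂ (z≤x , _) = x , x∈C , λ { zero → O.<-≤ x₀<z z≤x ; (Fin.suc i) → xs<x i }

    cover₂ : ∀ x y → ∃ λ z → C z × code x O.< proj₁ z × code y O.< proj₁ z
    cover₂ x y with cover (x ∷ y ∷ [])
    ... | z , z∈C , <z = z , z∈C , <z zero , <z (Fin.suc zero)

    glue-cong : ∀ s {x y} → x M.≈ y → glue s x M.≈ glue s y
    glue-cong s {x} {y} x≈y with cover₂ x y
    ... | (_ , σ) , σ∈C , x<α , y<α = M.trans (glue-agrees σ∈C s x<α)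
      (M.trans (act-cong s σ x≈y) (M.sym (glue-agrees σ∈C s y<α)))

    glue-inverseˡ : ∀ x → glue true (glue false x) M.≈ x
    -- The image of `x` may lie above a node that sees `x`, so one node is chosen above both.
    glue-inverseˡ x with cover₂ x (glue false x)
    ... | (_ , σ) , σ∈C , x<α , y<α = M.trans (glue-agrees σ∈C true y<α)
      (M.trans (Automorphism.to-cong σ (glue-agrees σ∈C false x<α))
        (Automorphism.strictlyInverseˡ σ x))

    glue-inverseʳ : ∀ x → glue false (glue true x) M.≈ x
    glue-inverseʳ x with cover₂ x (glue true x)
    ... | (_ , σ) , σ∈C , x<α , y<α = M.trans (glue-agrees σ∈C false y<α)
      (M.trans (Automorphism.from-cong σ (glue-agrees σ∈C true x<α))
        (Automorphism.strictlyInverseʳ σ x))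

    automorphism : Aut
    automorphism = record
      { inverse = record
        { to        = glue true
        ; from      = glue false
        ; to-cong   = glue-cong true
        ; from-cong = glue-cong false
        ; inverse   = (λ y≈ → M.trans (glue-cong true y≈) (glue-inverseˡ _))
                    , (λ y≈ → M.trans (glue-cong false y≈) (glue-inverseʳ _))
        }
      ; fun-homo = fun-homo
      ; rln-homo = rln-homo
      }
      where
      fun-homo : ∀ f xs → glue true (M.fun f xs) M.≈ M.fun f (glue true ∘ xs)
      -- The value `M.fun f xs` is also an argument of `glue`, so it has to lie below the node too.
      fun-homo f xs with cover (M.fun f xs ∷ xs)
      ... | (_ , σ) , σ∈C , <α = M.trans (glue-agrees σ∈C true (<α zero))
        (M.trans (Automorphism.fun-homo σ f xs)
          (M.fun-cong f (λ i → M.sym (glue-agrees σ∈C true (<α (Fin.suc i))))))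

      rln-homo : ∀ R xs → M.rln R xs ⇔ M.rln R (glue true ∘ xs)
      rln-homo R xs with cover xs
      ... | (_ , σ) , σ∈C , xs<α = mk⇔
        (M.rln-resp R (λ i → M.sym (glue-agrees σ∈C true (xs<α i))) ∘ Equivalence.to σ-homo)
        (Equivalence.from σ-homo ∘ M.rln-resp R (λ i → glue-agrees σ∈C true (xs<α i)))
        where σ-homo = Automorphism.rln-homo σ R xs

    -- By `glue-agrees` the nodes of `C` are restrictions of the glued map; maximality of `C` gives
    -- the other inclusion.
    branch-automorphism : branch automorphism ≐ C
    branch-automorphism = maximal (branch-isChain automorphism) C⊆branch , C⊆branch
      where
      agrees : ∀ {α σ} → C (α , σ) → ∀ s {x} → code x O.< α → act s σ x M.≈ act s automorphism x
      agrees σ∈C true  x<α = M.sym (glue-agrees σ∈C true x<α)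
      agrees σ∈C false x<α = M.sym (glue-agrees σ∈C false x<α)
      C⊆branch : C ⊆ branch automorphism
      C⊆branch σ∈C = agreement (agrees σ∈C)

  -- The bijection between automorphisms and uncountable branches.

  module _ (em : ExcludedMiddle ℓ) (isω₁ : IsOmega₁ O) where

    private
      module Glued (C : Setoid.Carrier (UncountableBranches tree)) =
        Glue em isω₁ (proj₁ (proj₂ C)) (proj₂ (proj₂ C))

      branch-resp : ∀ {σ τ} → Setoid._≈_ (Automorphisms M) σ τ → branch σ ≐ branch τ
      branch-resp {σ} {τ} σ≈τ =
        branch-cong (λ s → act-resp s {σ} {τ} σ≈τ) ,
        branch-cong (λ s x → M.sym (act-resp s {σ} {τ} σ≈τ x))

      -- The glued value at `x` is read off a node of `C`, which is a restriction of `σ`. This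
      -- yields both that gluing respects equality of branches and that it undoes `branch`.
      glue-unique : ∀ C σ → proj₁ C ⊆ branch σ →
                    Setoid._≈_ (Automorphisms M) (Glued.automorphism C) σ
      glue-unique C σ C⊆σ x with Glued.unbounded C (code x)
      ... | _ , τ∈C , x<α = agree (C⊆σ τ∈C) true x<α

    automorphisms≈branches : Automorphisms M ≈ᶜ UncountableBranches tree
    automorphisms≈branches = record
      { to        = λ σ → branch σ , branch-isBranch σ ,
                      branch-uncountable σ (IsOmega₁.uncountable isω₁)
      ; from      = Glued.automorphism
      ; to-cong   = λ {σ} {τ} → branch-resp {σ} {τ}
      ; from-cong = λ {C} {D} C≐D → glue-unique C (Glued.automorphism D)
                      (proj₂ (Glued.branch-automorphism D) ∘ proj₁ C≐D)
      ; inverse   = (λ {C} {σ} σ≈C →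
                      let σ⊆ , ⊆σ = branch-resp {σ} {Glued.automorphism C} σ≈C
                          ⊆C , C⊆ = Glued.branch-automorphism C
                      in ⊆C ∘ σ⊆ , ⊆σ ∘ C⊆)
                  , (λ {σ} {C} C≐σ → glue-unique C σ (proj₁ C≐σ))
      }

proposition15 :
  ∀ {ℓ : Level} → ExcludedMiddle (suc ℓ) →
  (ω₁ : WellOrder ℓ) → IsOmega₁ ω₁ →
  CH ω₁ →
  (Λ : Setoid ℓ ℓ) →
  WellOrder.asSetoid ω₁ <ᶜ Λ →
  Λ <ᶜ 2^ (WellOrder.asSetoid ω₁) →
  (V : Vocabulary ℓ) (M : Model V) →
  Model.universe M ≈ᶜ WellOrder.asSetoid ω₁ →
  Automorphisms M ≈ᶜ Λ →
  Σ (Tree ℓ) λ T →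
    TreeHasHeight ω₁ T ×
    UncountableBranches T ≈ᶜ Λ ×
    (∀ α → Level[_] ω₁ T α ≤ᶜ WellOrder.asSetoid ω₁)
proposition15 em ω₁ isω₁ ch Λ _ _ V M M≈ω₁ Aut≈Λ =
  tree , tree-hasHeight ,
  Compose.inverse (Symmetry.inverse (automorphisms≈branches em′ isω₁)) Aut≈Λ ,
  level≤ω₁ em′ isω₁ ch
  where
  open RestrictionTree ω₁ M (Inverse⇒Injection M≈ω₁)
  em′ = lowerEM em
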